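{- Let $G=(V,E)$ be a finite graph with at least one vertex and $k>0$ an integer. Then exactly one of the following holds: (i) $G$ has an $\mathcal F_k^{(2)}$-tangle of $S_k$; (ii) $G$ has an $S_k$-tree over $\mathcal F_k^{(2)}$.
   Context: An (oriented vertex) separation of $G$ is a pair $(A,B)$ of (possibly empty) subsets of $V$ with $A\cup B=V$ and no edge between $A\setminus B$ and $B\setminus A$; $\vec U$ is the set of these, ordered by $(A,B)\le(C,D)$ iff $A\subseteq C$ and $B\supseteq D$, inverse $(B,A)$; $\{A,B\}$ is the unoriented separation, of order $|A\cap B|$. $\vec S_k$: oriented separations of order $<k$; $S_k$: unoriented ones. An orientation of $S_k$ is a set $O\subseteq\vec S_k$ containing exactly one of $(A,B),(B,A)$ for each $\{A,B\}\in S_k$; it is consistent if there are no $(A,B),(C,D)\in\vec S_k$ with $\{A,B\}\ne\{C,D\}$, $(A,B)<(C,D)$, $(B,A)\in O$, $(C,D)\in O$. A star is a set $\sigma$ of separations with $(A,B)\ne(B,A)$ for each element and $(A,B)\le(D,C)$ for distinct $(A,B),(C,D)\in\sigma$. $\mathcal F_k$ is the set of stars $\{(A_i,B_i):i=0,\dots,n\}\subseteq\vec U$ with $|\bigcap_{i=0}^nB_i|<k$ (intersection $=V$ for the empty star), and $\mathcal F_k^{(2)}=\{\sigma\in\mathcal F_k:|\sigma|\le2\}$. An $\mathcal F_k^{(2)}$-tangle of $S_k$ is a consistent orientation of $S_k$ with no subset in $\mathcal F_k^{(2)}$. An $S_k$-tree over $\mathcal F_k^{(2)}$ is a pair $(T,\alpha)$,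 $T$ a finite tree with at least one node, $\alpha$ assigning to each ordered pair $(x,y)$ with $xy\in E(T)$ an element $\alpha(x,y)\in\vec S_k$ with $\alpha(y,x)$ the inverse of $\alpha(x,y)$ and $\{\alpha(x,t):xt\in E(T)\}\in\mathcal F_k^{(2)}$ for every node $t$. -}

module Defs where

open import Data.Nat using (ℕ; suc; _<_; _≤_)
open import Data.Fin using (Fin; toℕ; suc)
open import Data.Fin.Subset using (Subset; _∈_; _∉_; _⊆_; _∩_; ⊤; ∣_∣)
open import Data.Bool using (Bool; true; false)
open import Data.Product using (Σ; Σ-syntax; _×_; _,_; proj₂)
open import Data.Sum using (_⊎_)
open import Data.List using (List; foldr; map; length)
open import Data.List.Relation.Unary.All using (All)
open import Data.List.Relation.Unary.Unique.Propositional using (Unique)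
import Data.List.Membership.Propositional as LM
open import Relation.Binary.PropositionalEquality using (_≡_; _≢_)
open import Relation.Nullary using (¬_)

record Graph (n : ℕ) : Set where
  field
    adj    : Fin n → Fin n → Bool
    sym    : ∀ u v → adj u v ≡ adj v u
    irrefl : ∀ v → adj v v ≡ false

  Edge : Fin n → Fin n → Set
  Edge u v = adj u v ≡ true

open Graph public

Sep : ℕ → Set
Sep n = Subset n × Subset n

inv : ∀ {n} → Sep n → Sep n
inv (A , B) = (B , A)

IsSep : ∀ {n} → Graph n → Sep n → Set
IsSep {n} G (A , B) =
  (∀ (v : Fin n) → v ∈ A ⊎ v ∈ B) ×
  (∀ (u v : Fin n) → Edge G u v → u ∈ A → u ∉ B → v ∈ B → v ∉ A → Data.Empty.⊥)
  where import Data.Empty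

order : ∀ {n} → Sep n → ℕ
order (A , B) = ∣ A ∩ B ∣

InS⃗ : ∀ {n} → Graph n → ℕ → Sep n → Set
InS⃗ G k s = IsSep G s × order s < k

_≤ₛ_ : ∀ {n} → Sep n → Sep n → Set
(A , B) ≤ₛ (C , D) = A ⊆ C × D ⊆ B

_<ₛ_ : ∀ {n} → Sep n → Sep n → Set
x <ₛ y = x ≤ₛ y × x ≢ y

SameUnoriented : ∀ {n} → Sep n → Sep n → Set
SameUnoriented x y = x ≡ y ⊎ x ≡ inv y

IsOrientation : ∀ {n} → Graph n → ℕ → (Sep n → Set) → Set
IsOrientation G k O =
  (∀ s → O s → InS⃗ G k s) ×
  (∀ s → InS⃗ G k s → O s ⊎ O (inv s)) ×
  (∀ s → O s → O (inv s) → s ≡ inv s)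

IsConsistent : ∀ {n} → Graph n → ℕ → (Sep n → Set) → Set
IsConsistent G k O =
  ∀ x y → InS⃗ G k x → InS⃗ G k y → ¬ SameUnoriented x y →
  x <ₛ y → O (inv x) → O y → Data.Empty.⊥
  where import Data.Empty

-- Stars and F_k, F_k^(2).  A finite set of separations is given by a
-- duplicate-free list.

module _ {n : ℕ} where
  open LM {A = Sep n} renaming (_∈_ to _∈ₗ_)

  IsStar : List (Sep n) → Set
  IsStar σ =
    (∀ s → s ∈ₗ σ → s ≢ inv s) ×
    (∀ x y → x ∈ₗ σ → y ∈ₗ σ → x ≢ y → x ≤ₛ inv y)

  ⋂B : List (Sep n) → Subset n
  ⋂B σ = foldr _∩_ ⊤ (map proj₂ σ)

  InF : Graph n → ℕ → List (Sep n) → Set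
  InF G k σ = Unique σ × All (IsSep G) σ × IsStar σ × ∣ ⋂B σ ∣ < k

  InF2 : Graph n → ℕ → List (Sep n) → Set
  InF2 G k σ = InF G k σ × length σ ≤ 2

  SetInF2 : Graph n → ℕ → (Sep n → Set) → Set
  SetInF2 G k P = Σ[ σ ∈ List (Sep n) ]
    ((∀ s → s ∈ₗ σ → P s) × (∀ s → P s → s ∈ₗ σ) × InF2 G k σ)

IsTangle : ∀ {n} → Graph n → ℕ → (Sep n → Set) → Set
IsTangle G k O =
  IsOrientation G k O × IsConsistent G k O ×
  (∀ σ → InF2 G k σ → All O σ → Data.Empty.⊥)
  where import Data.Empty

HasTangle : ∀ {n} → Graph n → ℕ → Set₁
HasTangle {n} G k = Σ[ O ∈ (Sep n → Set) ] IsTangle G k O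

-- Finite trees with at least one node: nodes Fin (suc m); node 0 is a
-- root, and node (suc i) is joined to its parent (parent i), a node
-- with smaller index.  Every finite tree with ≥ 1 node is isomorphic to
-- one of this form, and each such structure is a tree.

record Tree : Set where
  field
    m       : ℕ
    parent  : Fin m → Fin (suc m)
    parent< : ∀ i → toℕ (parent i) ≤ toℕ i

  Node : Set
  Node = Fin (suc m)

open Tree public

-- An S_k-tree over F_k^(2).  The edge {suc i , parent i} is given the
-- orientation  α(suc i , parent i) = sep i,  and then
-- α(parent i , suc i) = inv (sep i).
record SkTree {n : ℕ} (G : Graph n) (k : ℕ) : Set where
  field
    T     : Tree
    sep   : Fin (m T) → Sep n
    sepS⃗ : ∀ i → InS⃗ G k (sep i)

  -- α(x , t) for the edges xt of T at the node t: for each child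
  -- x = suc i of t we get sep i; if t = suc j, its parent x gives
  -- α(parent j , suc j) = inv (sep j).
  Incoming : Node T → Sep n → Set
  Incoming t s =
    (Σ[ i ∈ Fin (m T) ] (parent T i ≡ t × s ≡ sep i)) ⊎
    (Σ[ j ∈ Fin (m T) ] (t ≡ suc j × s ≡ inv (sep j)))

  field
    star : ∀ (t : Node T) → SetInF2 G k (Incoming t)

HasSkTree : ∀ {n} → Graph n → ℕ → Set
HasSkTree G k = SkTree G k

{-# OPTIONS --safe #-}

-- A tree gives a sink of any orientation of its edges, so it excludes a
-- tangle.  Conversely, grow a down-closed set L of separations, starting from
-- those (A,B) with |A| < k, under the invariant that every sequence
-- r₀ ≤ … ≤ rₘ of separations of order < k with bags |Bᵢ ∩ Aᵢ₊₁| < k and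
-- r₀, inv rₘ ∈ L yields an S_k-tree.  Such a path can be shifted to any
-- separation r below its end that has least order between r and that end (by
-- submodularity), and this lets one add to L everything reachable from L and,
-- once L is closed under reachability, an undetermined separation of least
-- order.  When neither is possible and L never contains both orientations of a
-- separation, L is a tangle.
module Submission where

open import Defs renaming (sym to adj-sym)
open import Data.Bool using (true; false)
import Data.Bool.Properties as Bool
open import Data.Empty using (⊥; ⊥-elim)
open import Data.Fin using (Fin; zero; suc; toℕ; fromℕ; inject₁)
open import Data.Fin.Properties using (all?; toℕ-inject₁; inject₁-injective; fromℕ≢inject₁)
open import Data.Fin.Relation.Unary.Top using (view; ‵fromℕ; ‵inject₁)
open import Data.Fin.Subset hiding (⊥)
open import Data.Fin.Subset.Properties
open import Data.List using (List; []; _∷_; length; filter; map; _++_; cartesianProduct)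
open import Data.List.Membership.Propositional using () renaming (_∈_ to _∈ₗ_)
open import Data.List.Membership.Propositional.Properties using (∈-filter⁺; ∈-map⁺; ∈-++⁺ˡ; ∈-++⁺ʳ; ∈-cartesianProduct⁺)
open import Data.List.Properties using (filter-notAll)
open import Data.List.Relation.Unary.All as All using (All; []; _∷_)
open import Data.List.Relation.Unary.Any as Any using (Any; here; there)
open import Data.List.Relation.Unary.AllPairs using ([]; _∷_)
open import Data.Nat using (ℕ; zero; suc; _+_; _≤_; _<_; z≤n; s≤s; _<?_)
open import Data.Nat.Induction using (Acc; acc; <-wellFounded)
open import Data.Nat.Properties
open import Data.Product using (∃; _×_; _,_; proj₁; proj₂)
open import Data.Product.Properties using (≡-dec)
open import Data.Sum using (_⊎_; inj₁; inj₂; [_,_]′; map₂)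
import Data.Vec as Vec
import Data.Vec.Properties as Vec
open import Function using (_∘_)
open import Relation.Binary using (DecidableEquality)
open import Relation.Binary.Construct.Closure.ReflexiveTransitive using (Star; ε; _◅_; _◅◅_)
open import Relation.Binary.PropositionalEquality
open import Relation.Nullary using (¬_; Dec; yes; no; ¬?; _×-dec_; _⊎-dec_; _→-dec_)
open import Relation.Nullary.Decidable using (map′; decidable-stable)
open import Relation.Unary using (Decidable)

private variable
  n : ℕ

-- Submodularity of cardinalities.

∣p∪q∣+∣p∩q∣≡∣p∣+∣q∣ : ∀ (p q : Subset n) → ∣ p ∪ q ∣ + ∣ p ∩ q ∣ ≡ ∣ p ∣ + ∣ q ∣
∣p∪q∣+∣p∩q∣≡∣p∣+∣q∣ Vec.[] Vec.[] = refl
∣p∪q∣+∣p∩q∣≡∣p∣+∣q∣ (false Vec.∷ p) (false Vec.∷ q) = ∣p∪q∣+∣p∩q∣≡∣p∣+∣q∣ p q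
∣p∪q∣+∣p∩q∣≡∣p∣+∣q∣ (false Vec.∷ p) (true Vec.∷ q) =
  trans (cong suc (∣p∪q∣+∣p∩q∣≡∣p∣+∣q∣ p q)) (sym (+-suc ∣ p ∣ ∣ q ∣))
∣p∪q∣+∣p∩q∣≡∣p∣+∣q∣ (true Vec.∷ p) (false Vec.∷ q) = cong suc (∣p∪q∣+∣p∩q∣≡∣p∣+∣q∣ p q)
∣p∪q∣+∣p∩q∣≡∣p∣+∣q∣ (true Vec.∷ p) (true Vec.∷ q) = cong suc (begin
  ∣ p ∪ q ∣ + suc ∣ p ∩ q ∣   ≡⟨ +-suc ∣ p ∪ q ∣ ∣ p ∩ q ∣ ⟩
  suc (∣ p ∪ q ∣ + ∣ p ∩ q ∣) ≡⟨ cong suc (∣p∪q∣+∣p∩q∣≡∣p∣+∣q∣ p q) ⟩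
  suc (∣ p ∣ + ∣ q ∣)         ≡⟨ +-suc ∣ p ∣ ∣ q ∣ ⟨
  ∣ p ∣ + suc ∣ q ∣           ∎)
  where open ≡-Reasoning

-- For C ≡ C′ this is submodularity of the order; the extra room is what lets
-- a bag D ∩ C′ of a path decomposition shrink along with its separations.
bag-submodular : ∀ (A B C C′ D : Subset n) → C ⊆ C′ →
  ∣ (D ∪ B) ∩ (C′ ∩ A) ∣ + ∣ (C ∪ A) ∩ (D ∩ B) ∣ ≤ ∣ D ∩ C′ ∣ + ∣ A ∩ B ∣
bag-submodular A B C C′ D C⊆C′ = begin
  ∣ X ∣ + ∣ Y ∣         ≡⟨ ∣p∪q∣+∣p∩q∣≡∣p∣+∣q∣ X Y ⟨
  ∣ X ∪ Y ∣ + ∣ X ∩ Y ∣ ≤⟨ +-mono-≤ (p⊆q⇒∣p∣≤∣q∣ ∪⊆) (p⊆q⇒∣p∣≤∣q∣ ∩⊆) ⟩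
  ∣ P ∪ Q ∣ + ∣ P ∩ Q ∣ ≡⟨ ∣p∪q∣+∣p∩q∣≡∣p∣+∣q∣ P Q ⟩
  ∣ P ∣ + ∣ Q ∣         ∎
  where
  open ≤-Reasoning
  X = (D ∪ B) ∩ (C′ ∩ A)
  Y = (C ∪ A) ∩ (D ∩ B)
  P = D ∩ C′
  Q = A ∩ B

  X⊆ : X ⊆ P ∪ Q
  X⊆ v∈X with x∈p∩q⁻ (D ∪ B) (C′ ∩ A) v∈X
  ... | v∈D∪B , v∈C′∩A with x∈p∪q⁻ D B v∈D∪B | x∈p∩q⁻ C′ A v∈C′∩A
  ... | inj₁ v∈D | v∈C′ , v∈A = x∈p∪q⁺ (inj₁ (x∈p∩q⁺ (v∈D , v∈C′)))
  ... | inj₂ v∈B | v∈C′ , v∈A = x∈p∪q⁺ (inj₂ (x∈p∩q⁺ (v∈A , v∈B)))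

  Y⊆ : Y ⊆ P ∪ Q
  Y⊆ v∈Y with x∈p∩q⁻ (C ∪ A) (D ∩ B) v∈Y
  ... | v∈C∪A , v∈D∩B with x∈p∪q⁻ C A v∈C∪A | x∈p∩q⁻ D B v∈D∩B
  ... | inj₁ v∈C | v∈D , v∈B = x∈p∪q⁺ (inj₁ (x∈p∩q⁺ (v∈D , C⊆C′ v∈C)))
  ... | inj₂ v∈A | v∈D , v∈B = x∈p∪q⁺ (inj₂ (x∈p∩q⁺ (v∈A , v∈B)))

  ∪⊆ : X ∪ Y ⊆ P ∪ Q
  ∪⊆ v∈ = [ X⊆ , Y⊆ ]′ (x∈p∪q⁻ X Y v∈)

  ∩⊆ : X ∩ Y ⊆ P ∩ Q
  ∩⊆ v∈ with x∈p∩q⁻ X Y v∈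
  ... | v∈X , v∈Y with x∈p∩q⁻ C′ A (proj₂ (x∈p∩q⁻ (D ∪ B) (C′ ∩ A) v∈X))
                     | x∈p∩q⁻ D B (proj₂ (x∈p∩q⁻ (C ∪ A) (D ∩ B) v∈Y))
  ... | v∈C′ , v∈A | v∈D , v∈B = x∈p∩q⁺ (x∈p∩q⁺ (v∈D , v∈C′) , x∈p∩q⁺ (v∈A , v∈B))

-- The lattice of pairs of vertex sets.

_∧_ : Sep n → Sep n → Sep n
(A , B) ∧ (C , D) = A ∩ C , B ∪ D

_∨_ : Sep n → Sep n → Sep n
(A , B) ∨ (C , D) = A ∪ C , B ∩ D

≤ₛ-refl : {x : Sep n} → x ≤ₛ x
≤ₛ-refl = ⊆-refl , ⊆-refl

≤ₛ-trans : {x y z : Sep n} → x ≤ₛ y → y ≤ₛ z → x ≤ₛ z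
≤ₛ-trans (p , q) (r , s) = ⊆-trans p r , ⊆-trans s q

≤ₛ-antisym : {x y : Sep n} → x ≤ₛ y → y ≤ₛ x → x ≡ y
≤ₛ-antisym (p , q) (r , s) = cong₂ _,_ (⊆-antisym p r) (⊆-antisym s q)

inv-anti : {x y : Sep n} → x ≤ₛ y → inv y ≤ₛ inv x
inv-anti (p , q) = q , p

∧-lower₁ : (x y : Sep n) → (x ∧ y) ≤ₛ x
∧-lower₁ (A , B) (C , D) = p∩q⊆p A C , p⊆p∪q D

∧-lower₂ : (x y : Sep n) → (x ∧ y) ≤ₛ y
∧-lower₂ (A , B) (C , D) = p∩q⊆q A C , q⊆p∪q B D

∧-greatest : {x y z : Sep n} → z ≤ₛ x → z ≤ₛ y → z ≤ₛ (x ∧ y)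
∧-greatest {x = A , B} {C , D} (p , q) (r , s) =
  (λ v → x∈p∩q⁺ (p v , r v)) , (λ v → [ q , s ]′ (x∈p∪q⁻ B D v))

∧-mono : {x y : Sep n} (z : Sep n) → x ≤ₛ y → (x ∧ z) ≤ₛ (y ∧ z)
∧-mono {x = x} z x≤y = ∧-greatest (≤ₛ-trans (∧-lower₁ x z) x≤y) (∧-lower₂ x z)

∧-absorb : {x y : Sep n} → y ≤ₛ x → x ∧ y ≡ y
∧-absorb {x = x} {y} y≤x = ≤ₛ-antisym (∧-lower₂ x y) (∧-greatest y≤x ≤ₛ-refl)

∨-upper₁ : (x y : Sep n) → x ≤ₛ (x ∨ y)
∨-upper₁ x y = inv-anti (∧-lower₁ (inv x) (inv y))

∨-upper₂ : (x y : Sep n) → y ≤ₛ (x ∨ y)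
∨-upper₂ x y = inv-anti (∧-lower₂ (inv x) (inv y))

∨-least : {x y z : Sep n} → x ≤ₛ z → y ≤ₛ z → (x ∨ y) ≤ₛ z
∨-least x≤z y≤z = inv-anti (∧-greatest (inv-anti x≤z) (inv-anti y≤z))

-- Decidability and finite search.

_≟ₛ_ : DecidableEquality (Sep n)
_≟ₛ_ = ≡-dec (Vec.≡-dec Bool._≟_) (Vec.≡-dec Bool._≟_)

_≤ₛ?_ : (x y : Sep n) → Dec (x ≤ₛ y)
(A , B) ≤ₛ? (C , D) = (A ⊆? C) ×-dec (D ⊆? B)

anySep? : {P : Sep n → Set} → Decidable P → Dec (∃ P)
anySep? P? = map′ (λ { (A , B , p) → (A , B) , p }) (λ { ((A , B) , p) → A , B , p })
  (anySubset? λ A → anySubset? λ B → P? (A , B))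

allSubsets : ∀ n → List (Subset n)
allSubsets zero    = Vec.[] ∷ []
allSubsets (suc n) = map (true Vec.∷_) (allSubsets n) ++ map (false Vec.∷_) (allSubsets n)

∈-allSubsets : (p : Subset n) → p ∈ₗ allSubsets n
∈-allSubsets Vec.[]            = here refl
∈-allSubsets (true Vec.∷ p)    = ∈-++⁺ˡ (∈-map⁺ _ (∈-allSubsets p))
∈-allSubsets {suc n} (false Vec.∷ p) =
  ∈-++⁺ʳ (map (true Vec.∷_) (allSubsets n)) (∈-map⁺ _ (∈-allSubsets p))

minimiser : {P : Sep n → Set} → Decidable P → (f : Sep n → ℕ) → ∃ P →
  ∃ λ t → P t × (∀ s → P s → f t ≤ f s)
minimiser {P = P} P? f (s , Ps) = go s Ps (<-wellFounded (f s))
  where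
  go : ∀ s → P s → Acc _<_ (f s) → ∃ λ t → P t × (∀ s → P s → f t ≤ f s)
  go s Ps (acc rec) with anySep? (λ t → P? t ×-dec (f t <? f s))
  ... | yes (t , Pt , ft<fs) = go t Pt (rec ft<fs)
  ... | no none = s , Ps , λ t Pt → ≮⇒≥ (λ ft<fs → none (t , Pt , ft<fs))

-- Serves to find a sink in a tree: children carry higher numbers than their parents, so control is
-- needed above `j`, not below it.
last-inj₂ : ∀ {m} {P Q : Fin m → Set} → (∀ i → P i ⊎ Q i) →
  (∀ i → P i) ⊎ ∃ λ j → Q j × (∀ i → toℕ j < toℕ i → P i)
last-inj₂ {zero}  f = inj₁ λ ()
last-inj₂ {suc m} f with last-inj₂ (f ∘ suc) | f zero
... | inj₂ (j , Qj , P>j) | _      = inj₂ (suc j , Qj , λ { (suc i) (s≤s j<i) → P>j i j<i })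
... | inj₁ all            | inj₁ P0 = inj₁ λ { zero → P0 ; (suc i) → all i }
... | inj₁ all            | inj₂ Q0 = inj₂ (zero , Q0 , λ { (suc i) _ → all i })

-- Separations of a graph.

module _ {n : ℕ} (G : Graph n) where

  isSep? : Decidable (IsSep G)
  isSep? (A , B) =
    all? (λ v → (v ∈? A) ⊎-dec (v ∈? B)) ×-dec
    all? (λ u → all? (λ v → (adj G u v Bool.≟ true) →-dec ((u ∈? A) →-dec
      (¬? (u ∈? B) →-dec ((v ∈? B) →-dec (¬? (v ∈? A) →-dec no λ ()))))))

  isSep-inv : ∀ {s} → IsSep G s → IsSep G (inv s)
  isSep-inv (cover , noEdge) =
    (λ v → [ inj₂ , inj₁ ]′ (cover v)) ,
    (λ u v uv u∈B u∉A v∈A v∉B → noEdge v u (trans (adj-sym G v u) uv) v∈A v∉B u∈B u∉A)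

  isSep-∧ : ∀ {s t} → IsSep G s → IsSep G t → IsSep G (s ∧ t)
  isSep-∧ {A , B} {C , D} (cover₁ , noEdge₁) (cover₂ , noEdge₂) = cover , noEdge
    where
    cover : ∀ v → v ∈ A ∩ C ⊎ v ∈ B ∪ D
    cover v with cover₁ v | cover₂ v
    ... | inj₂ v∈B | _        = inj₂ (x∈p∪q⁺ (inj₁ v∈B))
    ... | _        | inj₂ v∈D = inj₂ (x∈p∪q⁺ (inj₂ v∈D))
    ... | inj₁ v∈A | inj₁ v∈C = inj₁ (x∈p∩q⁺ (v∈A , v∈C))

    noEdge : ∀ u v → Edge G u v → u ∈ A ∩ C → u ∉ B ∪ D → v ∈ B ∪ D → v ∉ A ∩ C → ⊥
    noEdge u v uv u∈A∩C u∉B∪D _ v∉A∩C with x∈p∩q⁻ A C u∈A∩C | v ∈? A | v ∈? C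
    ... | _ | yes v∈A | yes v∈C = v∉A∩C (x∈p∩q⁺ (v∈A , v∈C))
    ... | u∈A , _ | no v∉A | _ =
      noEdge₁ u v uv u∈A (u∉B∪D ∘ x∈p∪q⁺ ∘ inj₁) ([ ⊥-elim ∘ v∉A , (λ v∈B → v∈B) ]′ (cover₁ v)) v∉A
    ... | _ , u∈C | yes _ | no v∉C =
      noEdge₂ u v uv u∈C (u∉B∪D ∘ x∈p∪q⁺ ∘ inj₂) ([ ⊥-elim ∘ v∉C , (λ v∈D → v∈D) ]′ (cover₂ v)) v∉C

  isSep-∨ : ∀ {s t} → IsSep G s → IsSep G t → IsSep G (s ∨ t)
  isSep-∨ s t = isSep-inv (isSep-∧ (isSep-inv s) (isSep-inv t))

-- Paths of separations of order below `k`.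

module _ {n : ℕ} (G : Graph n) (k : ℕ) where

  private
    InS : Sep n → Set
    InS = InS⃗ G k

  order-inv : (s : Sep n) → order (inv s) ≡ order s
  order-inv (A , B) = cong ∣_∣ (∩-comm B A)

  inS? : Decidable InS
  inS? s = isSep? G s ×-dec (order s <? k)

  inS-inv : ∀ {s} → InS s → InS (inv s)
  inS-inv {s} (sep , <k) = isSep-inv G sep , subst (_< k) (sym (order-inv s)) <k

  -- The last bound is the one that membership in F_k puts on the star of `x` and `inv y`: a step is
  -- meant to become an inner node of a path-shaped tree.
  Step : Sep n → Sep n → Set
  Step x y = InS x × InS y × x ≤ₛ y × ∣ proj₂ x ∩ proj₁ y ∣ < k

  step? : ∀ x y → Dec (Step x y)
  step? x y = inS? x ×-dec (inS? y ×-dec ((x ≤ₛ? y) ×-dec (_ <? k)))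

  Path : Sep n → Sep n → Set
  Path = Star Step

  step-inv : ∀ {x y} → Step x y → Step (inv y) (inv x)
  step-inv {A , B} {C , D} (x∈S , y∈S , x≤y , bag<k) =
    inS-inv y∈S , inS-inv x∈S , inv-anti x≤y , subst (_< k) (cong ∣_∣ (∩-comm B C)) bag<k

  path-inv : ∀ {x y} → Path x y → Path (inv y) (inv x)
  path-inv ε       = ε
  path-inv (s ◅ p) = path-inv p ◅◅ (step-inv s ◅ ε)

  path-≤ : ∀ {x y} → Path x y → x ≤ₛ y
  path-≤ ε                     = ≤ₛ-refl
  path-≤ ((_ , _ , x≤y , _) ◅ p) = ≤ₛ-trans x≤y (path-≤ p)

  path-target : ∀ {x y} → InS x → Path x y → InS y
  path-target x∈S ε                    = x∈S
  path-target _ ((_ , y∈S , _) ◅ p) = path-target y∈S p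

  -- Shifting paths by submodularity.

  Linked : Sep n → Sep n → Set
  Linked r z = ∀ t → IsSep G t → r ≤ₛ t → t ≤ₛ z → order r ≤ order t

  linked-inv : ∀ {r z} → (∀ t → IsSep G t → z ≤ₛ t → t ≤ₛ r → order r ≤ order t) →
    Linked (inv r) (inv z)
  linked-inv {r} minimal t sep r≤t t≤z = subst₂ _≤_ (sym (order-inv r)) (order-inv t)
    (minimal (inv t) (isSep-inv G sep) (inv-anti t≤z) (inv-anti r≤t))

  -- The join `x ∨ r` lies between `r` and `z`, so its order is at least that of `r`. Cancelling
  -- this in `bag-submodular` leaves the claim.
  bag-shrinks : ∀ {x y r z} → IsSep G x → IsSep G r → x ≤ₛ y → x ≤ₛ z → r ≤ₛ z →
    Linked r z → ∣ proj₂ (x ∧ r) ∩ proj₁ (y ∧ r) ∣ ≤ ∣ proj₂ x ∩ proj₁ y ∣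
  bag-shrinks {x@(C , D)} {C′ , _} {r@(A , B)} x∈U r∈U x≤y x≤z r≤z linked =
    +-cancelʳ-≤ (order r) _ _ (≤-trans
      (+-monoʳ-≤ ∣ (D ∪ B) ∩ (C′ ∩ A) ∣
        (linked (x ∨ r) (isSep-∨ G x∈U r∈U) (∨-upper₂ x r) (∨-least x≤z r≤z)))
      (bag-submodular A B C C′ D (proj₁ x≤y)))

  -- The case `y = x` of `bag-shrinks`: the bag is then the separator, read as the order of the
  -- inverse.
  inS-∧ : ∀ {x r z} → InS x → InS r → x ≤ₛ z → r ≤ₛ z → Linked r z → InS (x ∧ r)
  inS-∧ {x} {r} x∈S r∈S x≤z r≤z linked =
    isSep-∧ G (proj₁ x∈S) (proj₁ r∈S) ,
    (begin-strict
      order (x ∧ r)       ≡⟨ order-inv (x ∧ r) ⟨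
      order (inv (x ∧ r)) ≤⟨ bag-shrinks (proj₁ x∈S) (proj₁ r∈S) ≤ₛ-refl x≤z r≤z linked ⟩
      order (inv x)       <⟨ proj₂ (inS-inv x∈S) ⟩
      k                   ∎)
    where open ≤-Reasoning

  -- Every separation on the path lies below `z`, so the same minimality of `r` serves at each step.
  path-∧ : ∀ {x z r} → Path x z → InS r → r ≤ₛ z → Linked r z → Path (x ∧ r) (z ∧ r)
  path-∧ ε _ _ _ = ε
  path-∧ {r = r} (step@(x∈S , y∈S , x≤y , bag<k) ◅ p) r∈S r≤z linked =
    ( inS-∧ x∈S r∈S (path-≤ (step ◅ p)) r≤z linked
    , inS-∧ y∈S r∈S (path-≤ p) r≤z linked
    , ∧-mono r x≤y
    , ≤-<-trans (bag-shrinks (proj₁ x∈S) (proj₁ r∈S) x≤y (path-≤ (step ◅ p)) r≤z linked) bag<k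
    ) ◅ path-∧ p r∈S r≤z linked

  shift-down : ∀ {x z r} → Path x z → InS r → r ≤ₛ z → Linked r z → Path (x ∧ r) r
  shift-down p r∈S r≤z linked = subst (Path _) (∧-absorb r≤z) (path-∧ p r∈S r≤z linked)

  shift-up : ∀ {x z r} → Path x z → InS r → x ≤ₛ r → Linked (inv r) (inv x) → Path r (z ∨ r)
  shift-up p r∈S x≤r linked =
    path-inv (shift-down (path-inv p) (inS-inv r∈S) (inv-anti x≤r) linked)

  -- The minimum is over separations of every order, as `Linked` demands; since `z` competes, the
  -- minimiser still has order below `k`.
  between : ∀ {x z} → x ≤ₛ z → InS z → ∃ λ t → InS t × x ≤ₛ t × t ≤ₛ z ×
    (∀ t′ → IsSep G t′ → x ≤ₛ t′ → t′ ≤ₛ z → order t ≤ order t′)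
  between {x} {z} x≤z z∈S
    with minimiser (λ t → isSep? G t ×-dec ((x ≤ₛ? t) ×-dec (t ≤ₛ? z))) order
                   (z , proj₁ z∈S , x≤z , ≤ₛ-refl)
  ... | t , (sep , x≤t , t≤z) , minimal =
    t , (sep , ≤-<-trans (minimal z (proj₁ z∈S , x≤z , ≤ₛ-refl)) (proj₂ z∈S)) , x≤t , t≤z ,
    λ t′ sep′ x≤t′ t′≤z → minimal t′ (sep′ , x≤t′ , t′≤z)

  -- Extending a down-closed set under the invariant.

  -- The invariant of the construction. The extension arguments never inspect `X`, which is later
  -- the type of S_k-trees.
  Implies-on-link : Set → (Sep n → Set) → Set
  Implies-on-link X L = ∀ {x y} → L x → L y → InS x → InS y → Path x (inv y) → X

  DownClosed : (Sep n → Set) → Set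
  DownClosed L = ∀ {x y} → x ≤ₛ y → L y → L x

  module _ {X : Set} {L : Sep n → Set} (down : DownClosed L) where

    Reachable : Sep n → Set
    Reachable s = ∃ λ l → L l × InS l × Path l s

    BelowReachable : Sep n → Set
    BelowReachable x = ∃ λ s → x ≤ₛ s × Reachable s

    reachable-∈S : ∀ {s} → Reachable s → InS s
    reachable-∈S (_ , _ , l∈S , p) = path-target l∈S p

    -- The shifted path starts at `l ∧ r` instead of `l`; down-closure keeps this start in `L`.
    reachable-down : ∀ {r z} → Reachable z → InS r → r ≤ₛ z → Linked r z → Reachable r
    reachable-down {r} (l , l∈L , l∈S , p) r∈S r≤z linked =
      l ∧ r , down (∧-lower₁ l r) l∈L , inS-∧ l∈S r∈S (path-≤ p) r≤z linked ,
      shift-down p r∈S r≤z linked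

    -- The path is shifted up at its start and down at its end, each time to a
    -- separation of least order, so that both ends become reachable.
    link-BelowReachable : Implies-on-link X L → Implies-on-link X BelowReachable
    link-BelowReachable link {x} {y} (s , x≤s , s-reach) (s′ , y≤s′ , s′-reach) x∈S y∈S path
      with between x≤s (reachable-∈S s-reach)
    ... | t , t∈S , x≤t , t≤s , t-min
      with reachable-down s-reach t∈S t≤s
             (λ t′ sep t≤t′ → t-min t′ sep (≤ₛ-trans x≤t t≤t′))
         | shift-up path t∈S x≤t
             (linked-inv (λ t′ sep x≤t′ t′≤t → t-min t′ sep x≤t′ (≤ₛ-trans t′≤t t≤s)))
    ... | l , l∈L , l∈S , l⇝t | t⇝z
      with between (≤ₛ-trans (inv-anti (∨-upper₁ (inv y) t)) y≤s′) (reachable-∈S s′-reach)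
    ... | p , p∈S , z≤p , p≤s′ , p-min
      with reachable-down s′-reach p∈S p≤s′
             (λ t′ sep p≤t′ → p-min t′ sep (≤ₛ-trans z≤p p≤t′))
         | reachable-down (l , l∈L , l∈S , l⇝t ◅◅ t⇝z) (inS-inv p∈S) (inv-anti z≤p)
             (linked-inv (λ t′ sep z≤t′ t′≤p → p-min t′ sep z≤t′ (≤ₛ-trans t′≤p p≤s′)))
    ... | l₁ , l₁∈L , l₁∈S , l₁⇝p | l₂ , l₂∈L , l₂∈S , l₂⇝p⁻¹ =
      link l₁∈L l₂∈L l₁∈S l₂∈S (l₁⇝p ◅◅ path-inv l₂⇝p⁻¹)

    -- Every separation of order below `k` in the enlarged set lies below a reachable one: itself,
    -- through the empty path, or `s`.
    link-extend-reachable : ∀ {s} → Reachable s → Implies-on-link X L →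
      Implies-on-link X (λ x → L x ⊎ x ≤ₛ s)
    link-extend-reachable {s} s-reach link x∈ y∈ x∈S y∈S =
      link-BelowReachable link (below x∈ x∈S) (below y∈ y∈S) x∈S y∈S
      where
      below : ∀ {x} → L x ⊎ x ≤ₛ s → InS x → BelowReachable x
      below {x} (inj₁ x∈L) x∈S = x , ≤ₛ-refl , x , x∈L , x∈S , ε
      below (inj₂ x≤s) _ = s , x≤s , s-reach

    -- No path of the kind in the invariant exists, so `X` follows vacuously. If one end is in `L`,
    -- closure carries membership along the path. If both ends are below `s`, the path is shifted
    -- down to end at `inv s`; its new start is small, so closure puts `inv s` in `L`.
    link-extend-undetermined : ∀ {s} →
      (∀ {x} → ∣ proj₁ x ∣ < k → L x) →
      (∀ {x y} → L x → Step x y → L y) →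
      (∀ {x} → InS x → L x → L (inv x) → ⊥) →
      InS s → ¬ L (inv s) → (∀ t → InS t → order t < order s → L t ⊎ L (inv t)) →
      Implies-on-link X (λ x → L x ⊎ x ≤ₛ s)
    link-extend-undetermined {s} small closed disjoint s∈S s⁻¹∉L determined = link
      where
      path-closed : ∀ {x y} → L x → Path x y → L y
      path-closed x∈L ε       = x∈L
      path-closed x∈L (s ◅ p) = path-closed (closed x∈L s) p

      half-link : ∀ {x y} → L x → L y ⊎ y ≤ₛ s → InS y → Path x (inv y) → ⊥
      half-link x∈L (inj₁ y∈L) y∈S p = disjoint y∈S y∈L (path-closed x∈L p)
      half-link x∈L (inj₂ y≤s) y∈S p = s⁻¹∉L (down (inv-anti y≤s) (path-closed x∈L p))

      -- The first side of the meet is contained in the separator of `s`.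
      meet-inv-small : ∀ {x} → x ≤ₛ s → ∣ proj₁ (x ∧ inv s) ∣ < k
      meet-inv-small {A , B} (A⊆C , _) = ≤-<-trans
        (p⊆q⇒∣p∣≤∣q∣ λ v∈ → let v∈A , v∈D = x∈p∩q⁻ A (proj₂ s) v∈ in x∈p∩q⁺ (A⊆C v∈A , v∈D))
        (proj₂ s∈S)

      link : Implies-on-link X (λ x → L x ⊎ x ≤ₛ s)
      link (inj₁ x∈L) y∈ _ y∈S p = ⊥-elim (half-link x∈L y∈ y∈S p)
      link (inj₂ x≤s) (inj₁ y∈L) x∈S _ p = ⊥-elim (half-link y∈L (inj₂ x≤s) x∈S (path-inv p))
      link {x} {y} (inj₂ x≤s) (inj₂ y≤s) x∈S y∈S p =
        ⊥-elim (s⁻¹∉L (path-closed (small (meet-inv-small x≤s))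
          (shift-down p (inS-inv s∈S) (inv-anti y≤s) linked)))
        where
        linked : Linked (inv s) (inv y)
        -- A `t` of smaller order between `y` and `s` is determined. If `t` is in `L`, so is `y`,
        -- which is the case of one end in `L`; if `inv t` is in `L`, so is `inv s`.
        linked = linked-inv λ t sep y≤t t≤s → ≮⇒≥ λ t<s →
          [ (λ t∈L → half-link (down y≤t t∈L) (inj₂ x≤s) x∈S (path-inv p))
          , (λ t⁻¹∈L → s⁻¹∉L (down (inv-anti t≤s) t⁻¹∈L))
          ]′ (determined t (sep , <-trans t<s (proj₂ s∈S)) t<s)

  -- From paths to trees.

  -- If the two sides coincide, both are the whole vertex set and the order is `n`, which is at
  -- least `k`.
  inS⇒proper : k ≤ n → ∀ {s} → InS s → s ≢ inv s
  inS⇒proper k≤n {A , B} ((cover , _) , <k) s≡s⁻¹ = <-irrefl refl (begin-strict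
    k         ≤⟨ k≤n ⟩
    n         ≡⟨ ∣⊤∣≡n n ⟨
    ∣ ⊤ {n} ∣ ≤⟨ p⊆q⇒∣p∣≤∣q∣ {p = ⊤} (λ {v} _ → x∈p∩q⁺ (both v)) ⟩
    ∣ A ∩ B ∣ <⟨ <k ⟩
    k         ∎)
    where
    open ≤-Reasoning
    both : ∀ v → v ∈ A × v ∈ B
    both v = [ (λ v∈A → v∈A , subst (v ∈_) (cong proj₁ s≡s⁻¹) v∈A)
             , (λ v∈B → subst (v ∈_) (cong proj₂ s≡s⁻¹) v∈B , v∈B) ]′ (cover v)

  singleton-star : k ≤ n → ∀ {s} → InS s → ∣ proj₂ s ∣ < k → InF2 G k (s ∷ [])
  singleton-star k≤n {s} s∈S <k =
    ( [] ∷ []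
    , proj₁ s∈S ∷ []
    , ( (λ { _ (here refl) → inS⇒proper k≤n s∈S })
      , (λ { _ _ (here refl) (here refl) x≢x → ⊥-elim (x≢x refl) }) )
    , ≤-<-trans (p⊆q⇒∣p∣≤∣q∣ (p∩q⊆p (proj₂ s) ⊤)) <k
    ) , s≤s z≤n

  step-star : k ≤ n → ∀ {x y} → Step x y → SetInF2 G k (λ s → s ≡ x ⊎ s ≡ inv y)
  step-star k≤n {x} {y} (x∈S , y∈S , x≤y , bag<k) with x ≟ₛ inv y
  -- The two separations coincide, so a duplicate-free list holds just one, and the bag is all of
  -- `proj₁ y`.
  ... | yes refl =
    x ∷ [] , (λ { _ (here eq) → inj₁ eq }) , (λ _ → [ here , here ]′) ,
    singleton-star k≤n x∈S
      (≤-<-trans (p⊆q⇒∣p∣≤∣q∣ {p = proj₁ y} (λ v∈ → x∈p∩q⁺ (v∈ , v∈))) bag<k)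
  ... | no x≢y⁻¹ =
    x ∷ inv y ∷ [] ,
    (λ { _ (here eq) → inj₁ eq ; _ (there (here eq)) → inj₂ eq }) ,
    (λ _ → [ here , there ∘ here ]′) ,
    ( (x≢y⁻¹ ∷ []) ∷ [] ∷ []
    , proj₁ x∈S ∷ isSep-inv G (proj₁ y∈S) ∷ []
    , ( (λ { _ (here refl) → inS⇒proper k≤n x∈S
           ; _ (there (here refl)) → inS⇒proper k≤n (inS-inv y∈S) })
      , (λ { _ _ (here refl) (here refl) x≢x → ⊥-elim (x≢x refl)
           ; _ _ (here refl) (there (here refl)) _ → x≤y
           ; _ _ (there (here refl)) (here refl) _ → inv-anti x≤y
           ; _ _ (there (here refl)) (there (here refl)) x≢x → ⊥-elim (x≢x refl) }) )
    , subst (λ p → ∣ proj₂ x ∩ p ∣ < k) (sym (∩-identityʳ (proj₁ y))) bag<k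
    ) , s≤s (s≤s z≤n)

  -- A path in indexed form, to match trees on `Fin`; `len` counts steps, so there are `suc len`
  -- separations.
  record Chain (x z : Sep n) : Set where
    field
      {len}  : ℕ
      at     : Fin (suc len) → Sep n
      first  : at zero ≡ x
      last   : at (fromℕ len) ≡ z
      linked : ∀ i → Step (at (inject₁ i)) (at (suc i))

  path→chain : ∀ {x z} → Path x z → Chain x z
  path→chain {x} ε = record { len = 0 ; at = λ _ → x ; first = refl ; last = refl ; linked = λ () }
  path→chain {x} (step ◅ p) = record
    { len    = suc len
    ; at     = λ { zero → x ; (suc i) → at i }
    ; first  = refl
    ; last   = last
    ; linked = λ { zero → subst (Step x) (sym first) step ; (suc i) → linked i }
    }
    where open Chain (path→chain p)

  chain-∈S : ∀ {x z} → InS x → (c : Chain x z) → ∀ i → InS (Chain.at c i)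
  chain-∈S x∈S c zero    = subst InS (sym (Chain.first c)) x∈S
  chain-∈S x∈S c (suc i) = proj₁ (proj₂ (Chain.linked c i))

  -- The separations of the path become the edges of a path graph and its steps the inner nodes. The
  -- two leaves receive `inv x` and `inv y`, whose second sides are small.
  link→tree : k ≤ n → ∀ {x y} → ∣ proj₁ x ∣ < k → ∣ proj₁ y ∣ < k → InS x → InS y →
    Path x (inv y) → SkTree G k
  link→tree k≤n {x} {y} x<k y<k x∈S y∈S p = record
    { T = record { m = suc len ; parent = inject₁ ; parent< = λ i → ≤-reflexive (toℕ-inject₁ i) }
    -- `sep` points from child to parent, whereas the chain ascends away from the root.
    ; sep = λ i → inv (at i)
    ; sepS⃗ = λ i → inS-inv (chain-∈S x∈S chain i)
    ; star = star
    }
    where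
    chain : Chain x (inv y)
    chain = path→chain p
    open Chain chain

    Incoming : Fin (suc (suc len)) → Sep n → Set
    Incoming t s =
      (∃ λ i → inject₁ i ≡ t × s ≡ inv (at i)) ⊎ (∃ λ j → t ≡ suc j × s ≡ at j)

    star : ∀ t → SetInF2 G k (Incoming t)
    star zero =
      inv x ∷ [] ,
      (λ { _ (here refl) → inj₁ (zero , refl , cong inv (sym first)) }) ,
      (λ { _ (inj₁ (zero , _ , refl)) → here (cong inv first)
         ; _ (inj₁ (suc _ , () , _)) ; _ (inj₂ (_ , () , _)) }) ,
      singleton-star k≤n (inS-inv x∈S) x<k
    star (suc j) with view j
    ... | ‵fromℕ =
      inv y ∷ [] ,
      (λ { _ (here refl) → inj₂ (fromℕ len , refl , sym last) }) ,
      (λ { _ (inj₁ (_ , eq , _)) → ⊥-elim (fromℕ≢inject₁ (sym eq))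
         ; _ (inj₂ (_ , refl , refl)) → here last }) ,
      singleton-star k≤n (inS-inv y∈S) y<k
    ... | ‵inject₁ i with step-star k≤n (linked i)
    ... | σ , σ⊆ , ⊆σ , σ∈F =
      σ ,
      (λ s s∈σ → [ (λ eq → inj₂ (inject₁ i , refl , eq))
                 , (λ eq → inj₁ (suc i , refl , eq)) ]′ (σ⊆ s s∈σ)) ,
      (λ { s (inj₁ (_ , eq , refl)) → ⊆σ s (inj₂ (cong (inv ∘ at) (inject₁-injective eq)))
         ; s (inj₂ (_ , refl , eq)) → ⊆σ s (inj₁ eq) }) ,
      σ∈F

  -- From saturated sets to tangles.

  module _ {L : Sep n → Set} where

    -- Consistency comes from down-closure. A singleton star contradicts `small`; a star of `s` and
    -- `t` is a step from `s` to `inv t`, contradicting `closed`; the empty star has intersection of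
    -- size `n`, at least `k`.
    saturated→tangle : k ≤ n → DownClosed L →
      (∀ {x} → ∣ proj₁ x ∣ < k → L x) →
      (∀ {x y} → L x → Step x y → L y) →
      (∀ {x} → InS x → L x → L (inv x) → ⊥) →
      (∀ x → InS x → L x ⊎ L (inv x)) →
      HasTangle G k
    saturated→tangle k≤n down small closed disjoint determined =
      (λ s → InS s × L s) ,
      ( (λ _ → proj₁)
      , (λ s s∈S → [ inj₁ ∘ (s∈S ,_) , inj₂ ∘ (inS-inv s∈S ,_) ]′ (determined s s∈S))
      , (λ { _ (s∈S , s∈L) (_ , s⁻¹∈L) → ⊥-elim (disjoint s∈S s∈L s⁻¹∈L) }) ) ,
      (λ { _ _ x∈S _ _ (x≤y , _) (_ , x⁻¹∈L) (_ , y∈L) → disjoint x∈S (down x≤y y∈L) x⁻¹∈L }) ,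
      noStar
      where
      noStar : ∀ σ → InF2 G k σ → All (λ s → InS s × L s) σ → ⊥
      noStar [] ((_ , _ , _ , ⊤<k) , _) [] =
        <-irrefl (∣⊤∣≡n n) (<-≤-trans ⊤<k k≤n)
      noStar (s ∷ []) ((_ , _ , _ , <k) , _) ((s∈S , s∈L) ∷ []) =
        disjoint s∈S s∈L (small (subst (λ p → ∣ p ∣ < k) (∩-identityʳ (proj₂ s)) <k))
      noStar (s ∷ t ∷ []) (((s≢t ∷ []) ∷ _ , _ , (_ , star) , <k) , _)
        ((s∈S , s∈L) ∷ (t∈S , t∈L) ∷ []) =
        disjoint t∈S t∈L (closed s∈L
          ( s∈S , inS-inv t∈S , star s t (here refl) (there (here refl)) s≢t
          , subst (λ p → ∣ proj₂ s ∩ p ∣ < k) (∩-identityʳ (proj₂ t)) <k ))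
      noStar (_ ∷ _ ∷ _ ∷ _) (_ , s≤s (s≤s ())) _

  -- Saturation.

  -- A finite list of generators keeps membership in the growing set decidable.
  Generated : List (Sep n) → Sep n → Set
  Generated gens s = ∣ proj₁ s ∣ < k ⊎ Any (s ≤ₛ_) gens

  generated? : ∀ gens → Decidable (Generated gens)
  generated? gens s = (_ <? k) ⊎-dec Any.any? (s ≤ₛ?_) gens

  generated-down : ∀ gens → DownClosed (Generated gens)
  generated-down _ x≤y = [ inj₁ ∘ ≤-<-trans (p⊆q⇒∣p∣≤∣q∣ (proj₁ x≤y)) , inj₂ ∘ Any.map (≤ₛ-trans x≤y) ]′

  generated-∷⁻ : ∀ {t gens s} → Generated (t ∷ gens) s → Generated gens s ⊎ s ≤ₛ t
  generated-∷⁻ (inj₁ <k)          = inj₁ (inj₁ <k)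
  generated-∷⁻ (inj₂ (here s≤t))  = inj₂ s≤t
  generated-∷⁻ (inj₂ (there any)) = inj₁ (inj₂ any)

  generated-∷⁺ : ∀ {t gens s} → Generated gens s → Generated (t ∷ gens) s
  generated-∷⁺ = map₂ there

  tangle-or-tree : k ≤ n → HasTangle G k ⊎ HasSkTree G k
  tangle-or-tree k≤n = saturate [] seps (<-wellFounded _)
    (λ { (A , B) _ → ∈-cartesianProduct⁺ (∈-allSubsets A) (∈-allSubsets B) })
    -- Without generators both ends are small, so the invariant is `link→tree`.
    λ { (inj₁ x<k) (inj₁ y<k) → link→tree k≤n x<k y<k }
    where
    seps : List (Sep n)
    seps = cartesianProduct (allSubsets n) (allSubsets n)

    saturate : ∀ gens todo → Acc _<_ (length todo) →
      (∀ s → ¬ Generated gens s → s ∈ₗ todo) →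
      Implies-on-link (SkTree G k) (Generated gens) →
      HasTangle G k ⊎ HasSkTree G k
    saturate gens todo (acc rec) covers link = close
      where
      L : Sep n → Set
      L = Generated gens

      L? : Decidable L
      L? = generated? gens

      add : ∀ t → ¬ L t → Implies-on-link (SkTree G k) (λ x → L x ⊎ x ≤ₛ t) →
        HasTangle G k ⊎ HasSkTree G k
      add t t∉L link′ = saturate (t ∷ gens) (filter (¬? ∘ (_≟ₛ t)) todo)
        (rec (filter-notAll _ todo (Any.map (λ t≡s s≢t → s≢t (sym t≡s)) (covers t t∉L))))
        (λ s s∉ → ∈-filter⁺ _ (covers s (s∉ ∘ generated-∷⁺))
                    (λ { refl → s∉ (inj₂ (here ≤ₛ-refl)) }))
        (λ x∈ y∈ → link′ (generated-∷⁻ x∈) (generated-∷⁻ y∈))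

      Undetermined : Sep n → Set
      Undetermined s = InS s × ¬ L s × ¬ L (inv s)

      undetermined? : Decidable Undetermined
      undetermined? s = inS? s ×-dec (¬? (L? s) ×-dec ¬? (L? (inv s)))

      determined : ∀ s → InS s → ¬ Undetermined s → L s ⊎ L (inv s)
      determined s s∈S ¬u = decidable-stable (L? s ⊎-dec L? (inv s))
        λ ¬d → ¬u (s∈S , ¬d ∘ inj₁ , ¬d ∘ inj₂)

      orient : (∀ {x y} → L x → Step x y → L y) → (∀ {x} → InS x → L x → L (inv x) → ⊥) →
        HasTangle G k ⊎ HasSkTree G k
      orient closed disjoint with anySep? undetermined?
      ... | no none = inj₁ (saturated→tangle k≤n (generated-down gens) inj₁ closed disjoint
                        λ x x∈S → determined x x∈S λ u → none (x , u))
      ... | yes some with minimiser undetermined? order some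
      -- Least order among the undetermined separations makes all those of smaller order determined.
      ... | s , (s∈S , s∉L , s⁻¹∉L) , minimal =
        add s s∉L (link-extend-undetermined (generated-down gens) inj₁ closed disjoint s∈S s⁻¹∉L
          λ t t∈S t<s → determined t t∈S λ u → <⇒≱ t<s (minimal t u))

      close : HasTangle G k ⊎ HasSkTree G k
      close with anySep? (λ r → anySep? λ t → L? r ×-dec (step? r t ×-dec ¬? (L? t)))
      ... | yes (r , t , r∈L , step , t∉L) =
        add t t∉L (link-extend-reachable (generated-down gens) (r , r∈L , proj₁ step , step ◅ ε) link)
      ... | no closed with anySep? (λ s → inS? s ×-dec (L? s ×-dec L? (inv s)))
      -- The empty path leads from `s` to `inv (inv s)`, so the invariant applies.
      ... | yes (s , s∈S , s∈L , s⁻¹∈L) = inj₂ (link s∈L s⁻¹∈L s∈S (inS-inv s∈S) ε)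
      ... | no disjoint = orient
        (λ {x} {y} x∈L step → decidable-stable (L? y) λ y∉L → closed (x , y , x∈L , step , y∉L))
        (λ {x} x∈S x∈L x⁻¹∈L → disjoint (x , x∈S , x∈L , x⁻¹∈L))

  -- The one-node tree, and exclusion of tangles by trees.

  trivial-tree : n < k → SkTree G k
  trivial-tree n<k = record
    { T     = record { m = 0 ; parent = λ () ; parent< = λ () }
    ; sep   = λ ()
    ; sepS⃗ = λ ()
    ; star  = λ { zero → [] , (λ _ ()) , (λ { _ (inj₁ ()) ; _ (inj₂ ()) }) ,
        ([] , [] , ((λ _ ()) , λ _ _ ()) , subst (_< k) (sym (∣⊤∣≡n n)) n<k) , z≤n }
    }

  tangle-tree-disjoint : HasTangle G k → HasSkTree G k → ⊥
  tangle-tree-disjoint (O , (_ , total , _) , _ , noStar) tree =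
    let t , incoming∈O = sink
        σ , σ⊆ , _ , σ∈F = star t
    in noStar σ σ∈F (All.tabulate λ {s} s∈σ → incoming∈O s (σ⊆ s s∈σ))
    where
    open SkTree tree

    -- Orienting every edge by O, the highest-numbered node entered from its
    -- parent is a sink, because its children have higher numbers.
    sink : ∃ λ t → ∀ s → Incoming t s → O s
    sink with last-inj₂ (λ i → total (sep i) (sepS⃗ i))
    ... | inj₁ up = zero , λ { _ (inj₁ (i , _ , refl)) → up i ; _ (inj₂ (_ , () , _)) }
    ... | inj₂ (j , down , up) = suc j , λ
      { _ (inj₁ (i , i↑j , refl)) →
          up i (subst (λ p → toℕ p ≤ toℕ i) i↑j (parent< T i))
      ; _ (inj₂ (_ , refl , refl)) → down }

theorem7p1 : ∀ {n : ℕ} (G : Graph (suc n)) (k : ℕ) → 0 < k →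
    (HasTangle G k ⊎ HasSkTree G k) × ¬ (HasTangle G k × HasSkTree G k)
theorem7p1 {n} G k _ =
  [ inj₂ ∘ trivial-tree G k , tangle-or-tree G k ]′ (<-≤-connex (suc n) k) ,
  λ { (tangle , tree) → tangle-tree-disjoint G k tangle tree }
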